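{- Let $\mathcal{D}$ be a distribution on $[n]$, $\varepsilon>0$, and let $\mathcal{P}$ be any bounded-derivative property of functions $f:[n]\to\mathbb{R}$. There is a tester for $\mathcal{P}$ with respect to $\mathcal{D}$ with proximity parameter $\varepsilon$ making $24\,\varepsilon^{ -1}\Delta^*(\mathcal{D})$ queries.
   Context: A bounded-derivative property on $[n]$ is $\mathcal{P}=\{g:[n]\to\mathbb{R}: l(t)\le g(t+1)-g(t)\le u(t)\ \forall t\in[n-1]\}$ for some $l,u:[n-1]\to\mathbb{R}$ with $l(t)<u(t)$. A tester w.r.t. $\mathcal{D}$ with proximity parameter $\varepsilon$ knows $\mathcal{D}$, queries $f$, accepts with probability $>2/3$ if $f\in\mathcal{P}$ and rejects with probability $>2/3$ if $\min_{g\in\mathcal{P}}\Pr_{x\sim\mathcal{D}}[f(x)\ne g(x)]>\varepsilon$. $\Delta^*(\mathcal{D})$ is the minimum over binary search trees $T$ on $[n]$ of $\mathbb{E}_{v\sim\mathcal{D}}[\mathrm{depth}_T(v)]$, where depth is the number of edges to the root. -}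

module Defs where

open import Algebra.Bundles using (CommutativeRing)
open import Algebra.Structures using (IsCommutativeRing)
import Algebra.Definitions.RawMonoid as RawMonoidDefinitions
open import Data.Bool.Base using (Bool; true; false; if_then_else_)
import Data.Bool.Properties as Bool
open import Data.Empty using (⊥)
open import Data.Fin.Base using (Fin; zero; suc; inject₁; toℕ)
open import Data.Nat.Base as ℕ using (ℕ; zero; suc)
import Data.Nat.Properties as ℕ
open import Data.Product.Base using (Σ; ∃; ∃-syntax; _×_; proj₁)
open import Data.Unit.Base using (⊤)
open import Data.Vec.Functional using (Vector)
open import Level using (0ℓ) renaming (suc to lsuc)
open import Relation.Binary.Core using (Rel)
open import Relation.Binary.Definitions using (tri<; tri≈; tri>)
open import Relation.Binary.PropositionalEquality.Core using (_≡_; _≢_)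
open import Relation.Binary.Structures using (IsStrictTotalOrder)
import Relation.Binary.Construct.StrictToNonStrict as ToNonStrict
open import Relation.Nullary.Decidable.Core using (Dec; does; ¬?)

-- The classical real numbers, given by their axioms as a complete ordered
-- field (hence unique up to isomorphism).  Trichotomy is the decidable,
-- classical one.  The Archimedean property follows classically from
-- completeness; it is a separate field because extracting the bounding natural
-- number is not constructive.  _⁻¹ is total, with an unspecified value at 0#.
record Reals : Set (lsuc 0ℓ) where
  infix  8 _⁻¹ -_
  infixl 7 _*_
  infixl 6 _+_
  infix  4 _<_
  field
    ℝ                  : Set
    _+_ _*_            : ℝ → ℝ → ℝ
    -_ _⁻¹             : ℝ → ℝ
    0# 1#              : ℝ
    _<_                : Rel ℝ 0ℓ
    isCommutativeRing  : IsCommutativeRing _≡_ _+_ _*_ -_ 0# 1#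
    0≢1                : 0# ≢ 1#
    ⁻¹-inverseʳ        : ∀ x → x ≢ 0# → x * x ⁻¹ ≡ 1#
    isStrictTotalOrder : IsStrictTotalOrder _≡_ _<_
    +-monoˡ-<          : ∀ z {x y} → x < y → x + z < y + z
    *-pos              : ∀ {x y} → 0# < x → 0# < y → 0# < x * y

  commutativeRing : CommutativeRing 0ℓ 0ℓ
  commutativeRing = record { isCommutativeRing = isCommutativeRing }

  open IsStrictTotalOrder isStrictTotalOrder public using (compare; _≟_; _<?_)
  open RawMonoidDefinitions (CommutativeRing.+-rawMonoid commutativeRing) public
    using (sum) renaming (_×_ to _·_)

  infix 4 _≤_
  infixl 6 _-_

  _≤_ : Rel ℝ 0ℓ
  _≤_ = ToNonStrict._≤_ _≡_ _<_

  _-_ : ℝ → ℝ → ℝ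
  x - y = x + (- y)

  fromℕ : ℕ → ℝ
  fromℕ k = k · 1#

  UpperBound : (ℝ → Set) → ℝ → Set
  UpperBound S b = ∀ x → S x → x ≤ b

  field
    archimedean : ∀ x → ∃[ k ] x < fromℕ k
    complete    : (S : ℝ → Set) → ∃ S → ∃ (UpperBound S) →
                  ∃[ s ] (UpperBound S s × (∀ b → UpperBound S b → s ≤ b))

-- BST i j: binary search trees whose keys are exactly i, i+1, …, j-1.
data BST : ℕ → ℕ → Set where
  empty : ∀ {i} → BST i i
  node  : ∀ {i j} (k : ℕ) → BST i k → BST (suc k) j → BST i j

-- Number of edges from the root to the key v, following the search path.  The
-- value at empty is junk: it is never reached when i ≤ v < j.
depth : ∀ {i j} → BST i j → ℕ → ℕ
depth empty        v = 0
depth (node k l r) v with ℕ.<-cmp v k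
... | tri< _ _ _ = suc (depth l v)
... | tri≈ _ _ _ = 0
... | tri> _ _ _ = suc (depth r v)

module PropertyTesting (R : Reals) where
  open Reals R public

  IsMinimum : {A : Set} → (A → ℝ) → ℝ → Set
  IsMinimum h m = (∃[ a ] h a ≡ m) × (∀ a → m ≤ h a)

  -- The domain [n] = {1,…,n} is Fin n, shifted to start at 0.
  record Distribution (n : ℕ) : Set where
    field
      mass   : Vector ℝ n
      mass≥0 : ∀ x → 0# ≤ mass x
      total  : sum mass ≡ 1#

  open Distribution public

  𝔼 : ∀ {n} → Distribution n → Vector ℝ n → ℝ
  𝔼 D h = sum (λ x → mass D x * h x)

  Pr : ∀ {n} → Distribution n → {A : Fin n → Set} → (∀ x → Dec (A x)) → ℝ
  Pr D A? = sum (λ x → if does (A? x) then mass D x else 0#)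

  expectedDepth : ∀ {n} → Distribution n → BST 0 n → ℝ
  expectedDepth D T = 𝔼 D (λ v → fromℕ (depth T (toℕ v)))

  Is-Δ* : ∀ {n} → Distribution n → ℝ → Set
  Is-Δ* D = IsMinimum (expectedDepth D)

  -- A bounded-derivative property on [n] with n = suc m.  (Distributions on
  -- the empty domain do not exist, so n ≥ 1 loses nothing.)
  record BoundedDerivativeProperty (m : ℕ) : Set where
    field
      l u : Vector ℝ m
      l<u : ∀ t → l t < u t

  infix 4 _∈_
  _∈_ : ∀ {m} → Vector ℝ (suc m) → BoundedDerivativeProperty m → Set
  g ∈ P = ∀ t → l t ≤ g (suc t) - g (inject₁ t)
              × g (suc t) - g (inject₁ t) ≤ u t
    where open BoundedDerivativeProperty P

  disagreement : ∀ {n} → Distribution n → Vector ℝ n → Vector ℝ n → ℝ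
  disagreement D f g = Pr D (λ x → ¬? (f x ≟ g x))

  IsDistance : ∀ {m} → Distribution (suc m) → BoundedDerivativeProperty m →
               Vector ℝ (suc m) → ℝ → Set
  IsDistance D P f = IsMinimum {A = Σ _ (_∈ P)} (λ g → disagreement D f (proj₁ g))

  Far : ∀ {m} → Distribution (suc m) → BoundedDerivativeProperty m →
        ℝ → Vector ℝ (suc m) → Set
  Far D P ε f = ∃[ d ] (IsDistance D P f d × ε < d)

  -- Randomized adaptive query algorithms on functions Fin n → ℝ: halt with a
  -- verdict (true = accept), query the input at a point and continue depending
  -- on the answer, or draw fresh randomness from a finite distribution.
  data Algorithm (n : ℕ) : Set where
    halt   : Bool → Algorithm n
    query  : Fin n → (ℝ → Algorithm n) → Algorithm n
    sample : ∀ {k} → Distribution k → (Fin k → Algorithm n) → Algorithm n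

  PrVerdict : ∀ {n} → Bool → Algorithm n → Vector ℝ n → ℝ
  PrVerdict b (halt c)     f = if does (b Bool.≟ c) then 1# else 0#
  PrVerdict b (query x κ)  f = PrVerdict b (κ (f x)) f
  PrVerdict b (sample D κ) f = 𝔼 D (λ i → PrVerdict b (κ i) f)

  PrAccept PrReject : ∀ {n} → Algorithm n → Vector ℝ n → ℝ
  PrAccept = PrVerdict true
  PrReject = PrVerdict false

  -- On input f, at most q queries are made whatever the random outcomes.
  QueriesAtMost : ∀ {n} → ℕ → Algorithm n → Vector ℝ n → Set
  QueriesAtMost q       (halt _)     f = ⊤
  QueriesAtMost zero    (query _ _)  f = ⊥
  QueriesAtMost (suc q) (query x κ)  f = QueriesAtMost q (κ (f x)) f
  QueriesAtMost q       (sample _ κ) f = ∀ i → QueriesAtMost q (κ i) f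

  ⅔ : ℝ
  ⅔ = fromℕ 2 * fromℕ 3 ⁻¹

  record IsTester {m} (D : Distribution (suc m)) (ε : ℝ)
                  (P : BoundedDerivativeProperty m)
                  (T : Algorithm (suc m)) : Set where
    field
      accepts : ∀ f → f ∈ P → ⅔ < PrAccept T f
      rejects : ∀ f → Far D P ε f → ⅔ < PrReject T f

{-# OPTIONS --safe #-}
-- Fix an optimal search tree.  One round samples a key v and compares it with
-- each of its proper ancestors, querying both keys anew each time; this costs
-- 2 depth(v) queries, hence 2 Δ* on average.  Two keys that are both consistent
-- with all their ancestors are consistent with each other, through their lowest
-- common ancestor, so the consistent keys extend to a member of P, and for f
-- that is ε-far from P a round finds a violation with probability above ε.
-- Rounds are repeated, accepting as soon as the next one would exceed the budget
-- of 24 Δ*/ε queries.  By Wald's identity and Markov's inequality the budget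
-- runs out before a violation is found with probability at most 1/12; the same
-- argument bounds the effect of also limiting the number of rounds by 1/4.

module Submission where

open import Data.Nat.Base using (ℕ; suc)
open import Data.Product.Base using (_×_; ∃-syntax)
open import Defs

open import Algebra.Bundles using (CommutativeRing)
import Algebra.Properties.CommutativeMonoid.Sum as CommutativeMonoidSum
import Algebra.Properties.Monoid.Mult as MonoidMult
import Algebra.Properties.Ring as RingProperties
import Algebra.Properties.Semiring.Mult as SemiringMult
import Algebra.Properties.Semiring.Sum as SemiringSum
import Algebra.Solver.Ring as RingSolver
open import Algebra.Solver.Ring.AlmostCommutativeRing
  using (AlmostCommutativeRing; fromCommutativeRing; _-Raw-AlmostCommutative⟶_)
open import Data.Bool.Base using (Bool; true; false; if_then_else_)
open import Data.Fin.Base using (Fin; zero; suc; inject₁; toℕ)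
import Data.Fin.Properties as Fin
open import Data.Integer.Base as ℤ using (ℤ; -[1+_])
import Data.Integer.Properties as ℤ
open import Data.List.Base using (List; []; _∷_; length; map)
import Data.List.Properties as List
open import Data.List.Membership.Propositional using () renaming (_∈_ to _∈ˡ_)
open import Data.List.Membership.Propositional.Properties using (∈-map⁺)
open import Data.List.Relation.Unary.All as All using (All; []; _∷_)
open import Data.List.Relation.Unary.Any using (here; there)
import Data.Maybe.Base as Maybe
open import Data.Nat.Base as ℕ using (zero; z≤n; s≤s)
open import Data.Nat.DivMod using (_mod_; m<n⇒m%n≡m; m%n<n)
import Data.Nat.Properties as ℕ
open import Data.Product.Base using (Σ; ∃; _,_; proj₁; proj₂; uncurry)
import Data.Sign.Base as Sign
open import Data.Sum.Base using (inj₁; inj₂; [_,_]′)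
open import Data.Unit.Base using (tt)
open import Data.Vec.Functional using (Vector; tail)
open import Function.Base using (_∘_; id)
import Relation.Binary.Construct.StrictToNonStrict as ToNonStrict
open import Relation.Binary.Consequences using (dec⇒weaklyDec)
open import Relation.Binary.Definitions using (tri<; tri≈; tri>)
open import Relation.Binary.PropositionalEquality
  using (_≡_; refl; sym; trans; cong; cong₂; subst; subst₂; module ≡-Reasoning)
open import Relation.Binary.Structures using (IsDecTotalOrder; IsStrictTotalOrder)
open import Relation.Nullary.Decidable using (Dec; yes; no; does; ¬?; _×-dec_; _→-dec_)
open import Relation.Nullary.Negation using (¬_; contradiction)

-- The motive sees only the Boolean, because `Pr` and the algorithms branch on `does A?`; the
-- evidence still reaches each branch.
does-elim : ∀ {a q} {A : Set a} (Q : Bool → Set q) (A? : Dec A) →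
            (A → Q true) → (¬ A → Q false) → Q (does A?)
does-elim Q (yes a) t f = t a
does-elim Q (no ¬a) t f = f ¬a

-- Ordered-field arithmetic and a ring solver with integer coefficients.

module OrderedField (R : Reals) where
  open PropertyTesting R
  open CommutativeRing commutativeRing using (ring; semiring; +-monoid;
    +-identityˡ; +-identityʳ; -‿inverseʳ; *-identityˡ; *-comm; zeroˡ; zeroʳ)
  open RingProperties ring using (-‿distribˡ-*; -‿distribʳ-*; -‿involutive; -0#≈0#)
  open MonoidMult +-monoid using (×-homo-+)
  open SemiringMult semiring using (×1-homo-*)
  open IsStrictTotalOrder isStrictTotalOrder using ()
    renaming (trans to <-trans; irrefl to <-irrefl; asym to <-asym)
  open ≡-Reasoning

  -- Coefficient map of the solver, under which `con (ℤ.+ n)` is `fromℕ n` by computation. As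
  -- `fromℕ 1` is `1# + 0#`, a literal `1#` enters solver equations as a variable or is converted
  -- first.
  fromℤ : ℤ → ℝ
  fromℤ (ℤ.+ n)    = fromℕ n
  fromℤ -[1+ n ] = - fromℕ (suc n)

  private
    almostCommutativeRing : AlmostCommutativeRing _ _
    almostCommutativeRing = fromCommutativeRing commutativeRing

    open AlmostCommutativeRing almostCommutativeRing using (-‿+-comm; +-comm; +-assoc)

    shift-difference : ∀ a b → (1# + a) - (1# + b) ≡ a - b
    shift-difference a b = begin
      (1# + a) - (1# + b)         ≡⟨ cong₂ _+_ (+-comm 1# a) (sym (-‿+-comm 1# b)) ⟩
      (a + 1#) + (- 1# - b)       ≡⟨ +-assoc a 1# (- 1# - b) ⟩
      a + (1# + (- 1# - b))       ≡⟨ cong (a +_) (+-assoc 1# (- 1#) (- b)) ⟨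
      a + ((1# - 1#) - b)         ≡⟨ cong (λ c → a + (c - b)) (-‿inverseʳ 1#) ⟩
      a + (0# - b)                ≡⟨ cong (a +_) (+-identityˡ (- b)) ⟩
      a - b                       ∎

    fromℤ-⊖ : ∀ m n → fromℤ (m ℤ.⊖ n) ≡ fromℕ m - fromℕ n
    fromℤ-⊖ m       zero    = sym (trans (cong (fromℕ m +_) -0#≈0#) (+-identityʳ (fromℕ m)))
    fromℤ-⊖ zero    (suc n) = sym (+-identityˡ (- fromℕ (suc n)))
    fromℤ-⊖ (suc m) (suc n) = begin
      fromℤ (suc m ℤ.⊖ suc n)      ≡⟨ cong fromℤ (ℤ.[1+m]⊖[1+n]≡m⊖n m n) ⟩
      fromℤ (m ℤ.⊖ n)              ≡⟨ fromℤ-⊖ m n ⟩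
      fromℕ m - fromℕ n            ≡⟨ shift-difference (fromℕ m) (fromℕ n) ⟨
      fromℕ (suc m) - fromℕ (suc n) ∎

    fromℤ-neg : ∀ i → fromℤ (ℤ.- i) ≡ - fromℤ i
    fromℤ-neg (ℤ.+ zero)  = sym -0#≈0#
    fromℤ-neg (ℤ.+ suc n) = refl
    fromℤ-neg -[1+ n ]  = sym (-‿involutive (fromℕ (suc n)))

    fromℤ-+ : ∀ i j → fromℤ (i ℤ.+ j) ≡ fromℤ i + fromℤ j
    fromℤ-+ (ℤ.+ m)    (ℤ.+ n)    = ×-homo-+ 1# m n
    fromℤ-+ (ℤ.+ m)    -[1+ n ] = fromℤ-⊖ m (suc n)
    fromℤ-+ -[1+ m ] (ℤ.+ n)    = trans (fromℤ-⊖ n (suc m)) (+-comm (fromℕ n) (- fromℕ (suc m)))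
    fromℤ-+ -[1+ m ] -[1+ n ] = begin
      - fromℕ (suc (suc (m ℕ.+ n)))       ≡⟨ cong (λ k → - fromℕ (suc k)) (ℕ.+-suc m n) ⟨
      - fromℕ (suc m ℕ.+ suc n)           ≡⟨ cong -_ (×-homo-+ 1# (suc m) (suc n)) ⟩
      - (fromℕ (suc m) + fromℕ (suc n))   ≡⟨ -‿+-comm (fromℕ (suc m)) (fromℕ (suc n)) ⟨
      - fromℕ (suc m) - fromℕ (suc n)     ∎

    fromℤ-+◃ : ∀ n → fromℤ (Sign.+ ℤ.◃ n) ≡ fromℕ n
    fromℤ-+◃ n = cong fromℤ (ℤ.+◃n≡+n n)

    fromℤ--◃ : ∀ n → fromℤ (Sign.- ℤ.◃ n) ≡ - fromℕ n
    fromℤ--◃ n = trans (cong fromℤ (ℤ.-◃n≡-n n)) (fromℤ-neg (ℤ.+ n))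

    fromℤ-* : ∀ i j → fromℤ (i ℤ.* j) ≡ fromℤ i * fromℤ j
    fromℤ-* (ℤ.+ m)    (ℤ.+ n)    = trans (fromℤ-+◃ (m ℕ.* n)) (×1-homo-* m n)
    fromℤ-* (ℤ.+ m)    -[1+ n ] = begin
      fromℤ (Sign.- ℤ.◃ m ℕ.* suc n)    ≡⟨ fromℤ--◃ (m ℕ.* suc n) ⟩
      - fromℕ (m ℕ.* suc n)             ≡⟨ cong -_ (×1-homo-* m (suc n)) ⟩
      - (fromℕ m * fromℕ (suc n))       ≡⟨ -‿distribʳ-* (fromℕ m) (fromℕ (suc n)) ⟩
      fromℕ m * - fromℕ (suc n)         ∎
    fromℤ-* -[1+ m ] (ℤ.+ n)    = begin
      fromℤ (Sign.- ℤ.◃ suc m ℕ.* n)    ≡⟨ fromℤ--◃ (suc m ℕ.* n) ⟩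
      - fromℕ (suc m ℕ.* n)             ≡⟨ cong -_ (×1-homo-* (suc m) n) ⟩
      - (fromℕ (suc m) * fromℕ n)       ≡⟨ -‿distribˡ-* (fromℕ (suc m)) (fromℕ n) ⟩
      - fromℕ (suc m) * fromℕ n         ∎
    fromℤ-* -[1+ m ] -[1+ n ] = begin
      fromℕ (suc m ℕ.* suc n)               ≡⟨ ×1-homo-* (suc m) (suc n) ⟩
      fromℕ (suc m) * fromℕ (suc n)         ≡⟨ -‿involutive (fromℕ (suc m) * fromℕ (suc n)) ⟨
      - - (fromℕ (suc m) * fromℕ (suc n))   ≡⟨ cong -_ (-‿distribˡ-* (fromℕ (suc m)) (fromℕ (suc n))) ⟩
      - (- fromℕ (suc m) * fromℕ (suc n))   ≡⟨ -‿distribʳ-* (- fromℕ (suc m)) (fromℕ (suc n)) ⟩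
      - fromℕ (suc m) * - fromℕ (suc n)     ∎

    fromℤ-homomorphism : ℤ.+-*-rawRing -Raw-AlmostCommutative⟶ almostCommutativeRing
    fromℤ-homomorphism = record
      { ⟦_⟧    = fromℤ
      ; +-homo = fromℤ-+
      ; *-homo = fromℤ-*
      ; -‿homo = fromℤ-neg
      ; 0-homo = refl
      ; 1-homo = +-identityʳ 1#
      }

  open RingSolver ℤ.+-*-rawRing almostCommutativeRing fromℤ-homomorphism
    (λ i j → Maybe.map (cong fromℤ) (dec⇒weaklyDec ℤ._≟_ i j)) public
    using (solve; _:=_; _:+_; _:*_; _:-_; :-_; con)

  open IsDecTotalOrder (ToNonStrict.isDecTotalOrder _≡_ _<_ isStrictTotalOrder) public
    using (_≤?_) renaming (refl to ≤-refl; trans to ≤-trans; antisym to ≤-antisym; total to ≤-total)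

  ≮⇒≥ : ∀ {x y} → ¬ x < y → y ≤ x
  ≮⇒≥ {x} {y} x≮y with compare x y
  ... | tri< x<y _ _ = contradiction x<y x≮y
  ... | tri≈ _ x≡y _ = inj₂ (sym x≡y)
  ... | tri> _ _ y<x = inj₁ y<x

  <⇒≱ : ∀ {x y} → x < y → ¬ y ≤ x
  <⇒≱ x<y (inj₁ y<x)  = <-asym x<y y<x
  <⇒≱ x<y (inj₂ refl) = <-irrefl refl x<y

  <-≤-trans : ∀ {x y z} → x < y → y ≤ z → x < z
  <-≤-trans x<y (inj₁ y<z)  = <-trans x<y y<z
  <-≤-trans x<y (inj₂ refl) = x<y

  +-monoˡ-≤ : ∀ z {x y} → x ≤ y → x + z ≤ y + z
  +-monoˡ-≤ z (inj₁ x<y)  = inj₁ (+-monoˡ-< z x<y)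
  +-monoˡ-≤ z (inj₂ refl) = ≤-refl

  +-mono-≤ : ∀ {x y x′ y′} → x ≤ y → x′ ≤ y′ → x + x′ ≤ y + y′
  +-mono-≤ {x} {y} {x′} {y′} x≤y x′≤y′ = ≤-trans (+-monoˡ-≤ x′ x≤y)
    (subst₂ _≤_ (+-comm x′ y) (+-comm y′ y) (+-monoˡ-≤ y x′≤y′))

  +-mono-<-≤ : ∀ {x y x′ y′} → x < y → x′ ≤ y′ → x + x′ < y + y′
  +-mono-<-≤ {y = y} {x′ = x′} x<y (inj₁ x′<y′) =
    <-trans (+-monoˡ-< x′ x<y) (subst₂ _<_ (+-comm x′ y) (+-comm _ y) (+-monoˡ-< y x′<y′))
  +-mono-<-≤ {x′ = x′} x<y (inj₂ refl) = +-monoˡ-< x′ x<y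

  private
    cancel-difference : ∀ p x → p + (x - p) ≡ x
    cancel-difference = solve 2 (λ p x → p :+ (x :- p) := x) refl

    shift-by-difference : ∀ p q x y → q - p ≡ y - x → q + (x - p) ≡ y
    shift-by-difference p q x y eq = begin
      q + (x - p)   ≡⟨ solve 3 (λ p q x → q :+ (x :- p) := x :+ (q :- p)) refl p q x ⟩
      x + (q - p)   ≡⟨ cong (x +_) eq ⟩
      x + (y - x)   ≡⟨ cancel-difference x y ⟩
      y             ∎

  -- Linear inequalities are proved by adding up the hypotheses and comparing
  -- the differences of the two sides with the ring solver.
  ≤-by-difference : ∀ {p q x y} → p ≤ q → q - p ≡ y - x → x ≤ y
  ≤-by-difference {p} {q} {x} {y} p≤q eq =
    subst₂ _≤_ (cancel-difference p x) (shift-by-difference p q x y eq) (+-monoˡ-≤ (x - p) p≤q)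

  <-by-difference : ∀ {p q x y} → p < q → q - p ≡ y - x → x < y
  <-by-difference {p} {q} {x} {y} p<q eq =
    subst₂ _<_ (cancel-difference p x) (shift-by-difference p q x y eq) (+-monoˡ-< (x - p) p<q)

  *-monoʳ-< : ∀ {z x y} → 0# < z → x < y → z * x < z * y
  *-monoʳ-< {z} {x} {y} 0<z x<y = <-by-difference
    (*-pos 0<z (<-by-difference {y = y - x} x<y
      (solve 2 (λ x y → y :- x := y :- x :- con (ℤ.+ 0)) refl x y)))
    (solve 3 (λ x y z → z :* (y :- x) :- con (ℤ.+ 0) := z :* y :- z :* x) refl x y z)

  *-monoʳ-≤ : ∀ {z x y} → 0# ≤ z → x ≤ y → z * x ≤ z * y
  *-monoʳ-≤ (inj₁ 0<z)  (inj₁ x<y) = inj₁ (*-monoʳ-< 0<z x<y)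
  *-monoʳ-≤ (inj₁ _)    (inj₂ refl) = ≤-refl
  *-monoʳ-≤ {x = x} {y} (inj₂ refl) _ = inj₂ (trans (zeroˡ x) (sym (zeroˡ y)))

  *-monoˡ-≤ : ∀ {z x y} → 0# ≤ z → x ≤ y → x * z ≤ y * z
  *-monoˡ-≤ {z} {x} {y} 0≤z x≤y = subst₂ _≤_ (*-comm z x) (*-comm z y) (*-monoʳ-≤ 0≤z x≤y)

  *-cancelˡ-< : ∀ {z x y} → 0# ≤ z → z * x < z * y → x < y
  *-cancelˡ-< {x = x} {y} 0≤z zx<zy with x <? y
  ... | yes x<y = x<y
  ... | no  x≮y = contradiction (*-monoʳ-≤ 0≤z (≮⇒≥ x≮y)) (<⇒≱ zx<zy)

  *-nonneg : ∀ {x y} → 0# ≤ x → 0# ≤ y → 0# ≤ x * y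
  *-nonneg {x} {y} 0≤x 0≤y = subst (_≤ x * y) (zeroʳ x) (*-monoʳ-≤ 0≤x 0≤y)

  0<1 : 0# < 1#
  0<1 with compare 0# 1#
  ... | tri< 0<1 _ _ = 0<1
  ... | tri≈ _ 0≡1 _ = contradiction 0≡1 0≢1
  -- Were `1#` negative, `- 1#` would be positive, and so would its square, which is `1#`.
  ... | tri> _ _ 1<0 = contradiction 1<0 (<-asym (subst (0# <_) -1*-1≡1 (*-pos 0<-1 0<-1)))
    where
    0<-1 : 0# < - 1#
    0<-1 = <-by-difference 1<0 (solve 1 (λ x → con (ℤ.+ 0) :- x := :- x :- con (ℤ.+ 0)) refl 1#)
    -1*-1≡1 : - 1# * - 1# ≡ 1#
    -1*-1≡1 = begin
      - 1# * - 1#     ≡⟨ -‿distribˡ-* 1# (- 1#) ⟨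
      - (1# * - 1#)   ≡⟨ cong -_ (*-identityˡ (- 1#)) ⟩
      - - 1#          ≡⟨ -‿involutive 1# ⟩
      1#              ∎

  ⁻¹-inverseˡ : ∀ {x} → 0# < x → x ⁻¹ * x ≡ 1#
  ⁻¹-inverseˡ {x} 0<x = trans (*-comm (x ⁻¹) x) (⁻¹-inverseʳ x λ x≡0 → <-irrefl (sym x≡0) 0<x)

  ⁻¹-pos : ∀ {x} → 0# < x → 0# < x ⁻¹
  ⁻¹-pos {x} 0<x = *-cancelˡ-< (inj₁ 0<x)
    (subst₂ _<_ (sym (zeroʳ x)) (sym (trans (*-comm x (x ⁻¹)) (⁻¹-inverseˡ 0<x))) 0<1)

  fromℕ-nonneg : ∀ n → 0# ≤ fromℕ n
  fromℕ-nonneg zero    = ≤-refl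
  fromℕ-nonneg (suc n) = subst (_≤ 1# + fromℕ n) (+-identityˡ 0#) (+-mono-≤ (inj₁ 0<1) (fromℕ-nonneg n))

  fromℕ-pos : ∀ n → 0# < fromℕ (suc n)
  fromℕ-pos n = subst (_< 1# + fromℕ n) (+-identityˡ 0#) (+-mono-<-≤ 0<1 (fromℕ-nonneg n))

  fromℕ-+ : ∀ m n → fromℕ (m ℕ.+ n) ≡ fromℕ m + fromℕ n
  fromℕ-+ = ×-homo-+ 1#

  fromℕ-mono : ∀ {m n} → m ℕ.≤ n → fromℕ m ≤ fromℕ n
  fromℕ-mono {n = n} z≤n       = fromℕ-nonneg n
  fromℕ-mono (s≤s m≤n) = +-mono-≤ ≤-refl (fromℕ-mono m≤n)

  -- Downward search from an Archimedean bound. Later `q` serves as the query budget, and the strict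
  -- bound by `suc q` yields the strict error bound.
  floor : ∀ {x} → 0# ≤ x → ∃[ q ] (fromℕ q ≤ x × x < fromℕ (suc q))
  floor {x} 0≤x = uncurry search (archimedean x)
    where
    search : ∀ k → x < fromℕ k → ∃[ q ] (fromℕ q ≤ x × x < fromℕ (suc q))
    search zero    x<0 = contradiction 0≤x (<⇒≱ x<0)
    search (suc k) x<k with x <? fromℕ k
    ... | yes x<k′ = search k x<k′
    ... | no  x≮k′ = k , ≮⇒≥ x≮k′ , x<k

-- Linearity and monotonicity of expectation and probability.

module Expectation (R : Reals) where
  open PropertyTesting R
  open OrderedField R
  open CommutativeRing commutativeRing using (semiring; +-commutativeMonoid; *-identityʳ; *-identityˡ; zeroʳ)
  open CommutativeMonoidSum +-commutativeMonoid using (sum-cong-≋; ∑-distrib-+)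
  open SemiringSum semiring using (*-distribˡ-sum; *-distribʳ-sum)
  open ≡-Reasoning

  sum-mono : ∀ {n} {h k : Vector ℝ n} → (∀ x → h x ≤ k x) → sum h ≤ sum k
  sum-mono {zero}  h≤k = ≤-refl
  sum-mono {suc n} h≤k = +-mono-≤ (h≤k zero) (sum-mono (h≤k ∘ suc))

  module _ {n : ℕ} (D : Distribution n) where

    𝔼-mono : ∀ {h k} → (∀ x → h x ≤ k x) → 𝔼 D h ≤ 𝔼 D k
    𝔼-mono h≤k = sum-mono λ x → *-monoʳ-≤ (mass≥0 D x) (h≤k x)

    𝔼-cong : ∀ {h k} → (∀ x → h x ≡ k x) → 𝔼 D h ≡ 𝔼 D k
    𝔼-cong h≡k = sum-cong-≋ λ x → cong (mass D x *_) (h≡k x)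

    𝔼-+ : ∀ h k → 𝔼 D (λ x → h x + k x) ≡ 𝔼 D h + 𝔼 D k
    𝔼-+ h k = trans
      (sum-cong-≋ λ x → solve 3 (λ p a b → p :* (a :+ b) := p :* a :+ p :* b) refl (mass D x) (h x) (k x))
      (∑-distrib-+ (λ x → mass D x * h x) (λ x → mass D x * k x))

    𝔼-* : ∀ c h → 𝔼 D (λ x → c * h x) ≡ c * 𝔼 D h
    𝔼-* c h = trans
      (sum-cong-≋ λ x → solve 3 (λ p c a → p :* (c :* a) := c :* (p :* a)) refl (mass D x) c (h x))
      (sym (*-distribˡ-sum c (λ x → mass D x * h x)))

    𝔼-- : ∀ h k → 𝔼 D (λ x → h x - k x) ≡ 𝔼 D h - 𝔼 D k
    𝔼-- h k = begin
      𝔼 D (λ x → h x - k x)                     ≡⟨ cancel (𝔼 D (λ x → h x - k x)) (𝔼 D k) ⟨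
      (𝔼 D (λ x → h x - k x) + 𝔼 D k) - 𝔼 D k   ≡⟨ cong (_- 𝔼 D k) (𝔼-+ (λ x → h x - k x) k) ⟨
      𝔼 D (λ x → (h x - k x) + k x) - 𝔼 D k     ≡⟨ cong (_- 𝔼 D k) (𝔼-cong λ x → uncancel (h x) (k x)) ⟩
      𝔼 D h - 𝔼 D k                             ∎
      where
      cancel : ∀ a b → (a + b) - b ≡ a
      cancel = solve 2 (λ a b → (a :+ b) :- b := a) refl
      uncancel : ∀ a b → (a - b) + b ≡ a
      uncancel = solve 2 (λ a b → (a :- b) :+ b := a) refl

    𝔼-const : ∀ c → 𝔼 D (λ _ → c) ≡ c
    𝔼-const c = begin
      𝔼 D (λ _ → c)       ≡⟨ *-distribʳ-sum c (mass D) ⟨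
      sum (mass D) * c    ≡⟨ cong (_* c) (total D) ⟩
      1# * c              ≡⟨ *-identityˡ c ⟩
      c                   ∎

    indicator : {A : Fin n → Set} → (∀ x → Dec (A x)) → Vector ℝ n
    indicator A? x = if does (A? x) then 1# else 0#

    Pr≡𝔼-indicator : {A : Fin n → Set} (A? : ∀ x → Dec (A x)) → Pr D A? ≡ 𝔼 D (indicator A?)
    Pr≡𝔼-indicator A? = sum-cong-≋ λ x →
      does-elim (λ b → (if b then mass D x else 0#) ≡ mass D x * (if b then 1# else 0#)) (A? x)
        (λ _ → sym (*-identityʳ (mass D x))) (λ _ → sym (zeroʳ (mass D x)))

    Pr-mono : {A B : Fin n → Set} (A? : ∀ x → Dec (A x)) (B? : ∀ x → Dec (B x)) →
              (∀ x → A x → B x) → Pr D A? ≤ Pr D B?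
    Pr-mono A? B? A⊆B = sum-mono λ x →
      does-elim (λ b → (if b then mass D x else 0#) ≤ (if does (B? x) then mass D x else 0#)) (A? x)
        (λ a → does-elim (λ b → mass D x ≤ (if b then mass D x else 0#)) (B? x)
          (λ _ → ≤-refl) (λ ¬b → contradiction (A⊆B x a) ¬b))
        (λ _ → does-elim (λ b → 0# ≤ (if b then mass D x else 0#)) (B? x)
          (λ _ → mass≥0 D x) (λ _ → ≤-refl))

-- Search paths and common ancestors.

path : ∀ {i j} → BST i j → ℕ → List ℕ
path empty        v = []
path (node k l r) v with ℕ.<-cmp v k
... | tri< _ _ _ = k ∷ path l v
... | tri≈ _ _ _ = []
... | tri> _ _ _ = k ∷ path r v

length-path : ∀ {i j} (T : BST i j) v → length (path T v) ≡ depth T v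
length-path empty        v = refl
length-path (node k l r) v with ℕ.<-cmp v k
... | tri< _ _ _ = cong suc (length-path l v)
... | tri≈ _ _ _ = refl
... | tri> _ _ _ = cong suc (length-path r v)

-- Enlarging a subtree to the whole tree puts the root `b` at the front of the path, right behind
-- the key itself.
insert : ∀ {a b v : ℕ} {ws} → a ∈ˡ v ∷ ws → a ∈ˡ v ∷ b ∷ ws
insert (here a≡v)   = here a≡v
insert (there a∈ws) = there (there a∈ws)

-- Descend while both keys lie strictly on the same side of the root; the first root where this
-- fails separates them or equals one of them. The lists `x ∷ path T x` make ancestry reflexive to
-- include the latter case.
common-ancestor : ∀ {i j} (T : BST i j) {x y} → i ℕ.≤ x → x ℕ.≤ y → y ℕ.< j →
                  ∃[ k ] (x ℕ.≤ k × k ℕ.≤ y × k ∈ˡ x ∷ path T x × k ∈ˡ y ∷ path T y)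
common-ancestor empty i≤x x≤y y<i =
  contradiction (ℕ.≤-<-trans (ℕ.≤-trans i≤x x≤y) y<i) (ℕ.<-irrefl refl)
common-ancestor (node k l r) {x} {y} i≤x x≤y y<j with ℕ.<-cmp x k | ℕ.<-cmp y k
... | tri< _ _ _      | tri< y<k _ _  =
  let k′ , x≤k′ , k′≤y , k′∈x , k′∈y = common-ancestor l i≤x x≤y y<k
  in  k′ , x≤k′ , k′≤y , insert k′∈x , insert k′∈y
... | tri> _ _ k<x    | tri> _ _ _    =
  let k′ , x≤k′ , k′≤y , k′∈x , k′∈y = common-ancestor r k<x x≤y y<j
  in  k′ , x≤k′ , k′≤y , insert k′∈x , insert k′∈y
... | tri< x<k _ _    | tri≈ _ refl _ = k , x≤y , ℕ.≤-refl , there (here refl) , here refl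
... | tri< x<k _ _    | tri> _ _ k<y  = k , ℕ.<⇒≤ x<k , ℕ.<⇒≤ k<y , there (here refl) , there (here refl)
... | tri≈ _ refl _   | tri< y<k _ _  = contradiction (ℕ.≤-<-trans x≤y y<k) (ℕ.<-irrefl refl)
... | tri≈ _ refl _   | tri≈ _ refl _ = k , ℕ.≤-refl , ℕ.≤-refl , here refl , here refl
... | tri≈ _ refl _   | tri> _ _ k<y  = k , ℕ.≤-refl , x≤y , here refl , there (here refl)
... | tri> _ _ k<x    | tri< y<k _ _  = contradiction (ℕ.<-trans (ℕ.<-≤-trans k<x x≤y) y<k) (ℕ.<-irrefl refl)
... | tri> _ _ k<x    | tri≈ _ refl _ = contradiction (ℕ.<-≤-trans k<x x≤y) (ℕ.<-irrefl refl)

-- Pointwise minima and maxima, partial sums.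

module Extension (R : Reals) where
  open PropertyTesting R
  open OrderedField R

  infixl 6 _⊓_ _⊔_

  _⊓_ _⊔_ : ℝ → ℝ → ℝ
  a ⊓ b = [ (λ _ → a) , (λ _ → b) ]′ (≤-total a b)
  a ⊔ b = [ (λ _ → b) , (λ _ → a) ]′ (≤-total a b)

  module _ (a b : ℝ) where

    ⊓-elim : (Q : ℝ → Set) → (a ≤ b → Q a) → (b ≤ a → Q b) → Q (a ⊓ b)
    ⊓-elim Q p q with ≤-total a b
    ... | inj₁ a≤b = p a≤b
    ... | inj₂ b≤a = q b≤a

    ⊔-elim : (Q : ℝ → Set) → (b ≤ a → Q a) → (a ≤ b → Q b) → Q (a ⊔ b)
    ⊔-elim Q p q with ≤-total a b
    ... | inj₁ a≤b = q a≤b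
    ... | inj₂ b≤a = p b≤a

    ⊓-lower₁ : a ⊓ b ≤ a
    ⊓-lower₁ = ⊓-elim (_≤ a) (λ _ → ≤-refl) id

    ⊓-lower₂ : a ⊓ b ≤ b
    ⊓-lower₂ = ⊓-elim (_≤ b) id (λ _ → ≤-refl)

    ⊔-upper₁ : a ≤ a ⊔ b
    ⊔-upper₁ = ⊔-elim (a ≤_) (λ _ → ≤-refl) id

    ⊔-upper₂ : b ≤ a ⊔ b
    ⊔-upper₂ = ⊔-elim (b ≤_) id (λ _ → ≤-refl)

  -- The discrete antiderivative of `h` vanishing at the first point; it turns bounds on single
  -- steps into bounds between distant points.
  prefix : ∀ {m} → Vector ℝ m → Vector ℝ (suc m)
  prefix         h zero    = 0#
  prefix {suc m} h (suc t) = h zero + prefix (tail h) t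

  prefix-step : ∀ {m} (h : Vector ℝ m) t → prefix h (suc t) - prefix h (inject₁ t) ≡ h t
  prefix-step h zero    = solve 1 (λ a → a :+ con (ℤ.+ 0) :- con (ℤ.+ 0) := a) refl (h zero)
  prefix-step h (suc t) = trans
    (solve 3 (λ a b c → (a :+ b) :- (a :+ c) := b :- c) refl
      (h zero) (prefix (tail h) (suc t)) (prefix (tail h) (inject₁ t)))
    (prefix-step (tail h) t)

  monotone : ∀ {m} (h : Vector ℝ (suc m)) → (∀ t → h (inject₁ t) ≤ h (suc t)) →
             ∀ {x y} → toℕ x ℕ.≤ toℕ y → h x ≤ h y
  monotone         h step {zero}  {zero}  _         = ≤-refl
  monotone {suc m} h step {zero}  {suc y} _         =
    ≤-trans (step zero) (monotone (tail h) (step ∘ suc) {zero} {y} z≤n)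
  monotone {suc m} h step {suc x} {suc y} (s≤s x≤y) = monotone (tail h) (step ∘ suc) x≤y

  -- Consistency of values with a bounded-derivative property.

  module _ {m : ℕ} (P : BoundedDerivativeProperty m) where
    open BoundedDerivativeProperty P

    Lo Hi : Vector ℝ (suc m)
    Lo = prefix l
    Hi = prefix u

    -- For x before y, the values a at x and b at y respect the derivative
    -- bounds summed over the steps from x to y.
    Compatible : Fin (suc m) → ℝ → Fin (suc m) → ℝ → Set
    Compatible x a y b = a - Lo x ≤ b - Lo y × b - Hi y ≤ a - Hi x

    -- An ancestor may lie on either side of a key, so both orders are covered; for distinct points
    -- one of the implications is vacuous.
    Valid : Fin (suc m) → ℝ → Fin (suc m) → ℝ → Set
    Valid x a y b = (toℕ x ℕ.≤ toℕ y → Compatible x a y b) × (toℕ y ℕ.≤ toℕ x → Compatible y b x a)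

    valid? : ∀ x a y b → Dec (Valid x a y b)
    valid? x a y b = ((toℕ x ℕ.≤? toℕ y) →-dec compatible? x a y b)
               ×-dec ((toℕ y ℕ.≤? toℕ x) →-dec compatible? y b x a)
      where
      compatible? : ∀ x a y b → Dec (Compatible x a y b)
      compatible? x a y b = (a - Lo x ≤? b - Lo y) ×-dec (b - Hi y ≤? a - Hi x)

    compatible-refl : ∀ x a → Compatible x a x a
    compatible-refl x a = ≤-refl , ≤-refl

    -- `Compatible` is a pair of comparisons, of the values minus `Lo` and, reversed, of the values
    -- minus `Hi`, and each is transitive. This carries consistency through a common ancestor.
    compatible-trans : ∀ x y z {a b c} → Compatible x a y b → Compatible y b z c → Compatible x a z c
    compatible-trans x y z (p , q) (p′ , q′) = ≤-trans p p′ , ≤-trans q′ q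

    -- A member of `P` grows at least as fast as `Lo` and at most as fast as `Hi`, so `f - Lo` and
    -- `Hi - f` are both monotone.
    ∈⇒compatible : ∀ {f} → f ∈ P → ∀ {x y} → toℕ x ℕ.≤ toℕ y → Compatible x (f x) y (f y)
    ∈⇒compatible {f} f∈P {x} {y} x≤y =
      monotone (λ x → f x - Lo x) lower x≤y ,
      ≤-by-difference (monotone (λ x → Hi x - f x) upper x≤y)
        (solve 4 (λ a b c d → (b :- d) :- (a :- c) := (c :- a) :- (d :- b)) refl (Hi x) (Hi y) (f x) (f y))
      where
      rearrange : ∀ a b c d → (a - b) - (c - d) ≡ (a - c) - (b - d)
      rearrange = solve 4 (λ a b c d → (a :- b) :- (c :- d) := (a :- c) :- (b :- d)) refl
      lower : ∀ t → f (inject₁ t) - Lo (inject₁ t) ≤ f (suc t) - Lo (suc t)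
      lower t = ≤-by-difference (proj₁ (f∈P t))
        (trans (cong (λ d → (f (suc t) - f (inject₁ t)) - d) (sym (prefix-step l t)))
          (sym (rearrange (f (suc t)) (Lo (suc t)) (f (inject₁ t)) (Lo (inject₁ t)))))
      upper : ∀ t → Hi (inject₁ t) - f (inject₁ t) ≤ Hi (suc t) - f (suc t)
      upper t = ≤-by-difference (proj₂ (f∈P t))
        (trans (cong (_- (f (suc t) - f (inject₁ t))) (sym (prefix-step u t)))
          (sym (rearrange (Hi (suc t)) (f (suc t)) (Hi (inject₁ t)) (f (inject₁ t)))))

    ∈⇒valid : ∀ {f} → f ∈ P → ∀ x y → Valid x (f x) y (f y)
    ∈⇒valid f∈P x y = ∈⇒compatible f∈P , ∈⇒compatible f∈P

    -- Additive form of a single derivative constraint, in which it passes to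
    -- minima and maxima.
    Step : Fin m → ℝ → ℝ → Set
    Step t a b = a + l t ≤ b × b ≤ a + u t

    steps⇒∈ : ∀ g → (∀ t → Step t (g (inject₁ t)) (g (suc t))) → g ∈ P
    steps⇒∈ g steps t =
      ≤-by-difference (proj₁ (steps t))
        (solve 3 (λ a b l → b :- (a :+ l) := (b :- a) :- l) refl (g (inject₁ t)) (g (suc t)) (l t)) ,
      ≤-by-difference (proj₂ (steps t))
        (solve 3 (λ a b u → (a :+ u) :- b := u :- (b :- a)) refl (g (inject₁ t)) (g (suc t)) (u t))

    ∈⇒steps : ∀ g → g ∈ P → ∀ t → Step t (g (inject₁ t)) (g (suc t))
    ∈⇒steps g g∈P t =
      ≤-by-difference (proj₁ (g∈P t))
        (solve 3 (λ a b l → (b :- a) :- l := b :- (a :+ l)) refl (g (inject₁ t)) (g (suc t)) (l t)) ,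
      ≤-by-difference (proj₂ (g∈P t))
        (solve 3 (λ a b u → u :- (b :- a) := (a :+ u) :- b) refl (g (inject₁ t)) (g (suc t)) (u t))

    ⊓-∈ : ∀ g h → g ∈ P → h ∈ P → (λ x → g x ⊓ h x) ∈ P
    ⊓-∈ g h g∈P h∈P = steps⇒∈ (λ x → g x ⊓ h x) λ t →
      -- In each inequality the minimum on the larger side is split into cases; the one on the
      -- smaller side is bounded by either argument. For `⊔` the sides are exchanged.
      ⊓-elim (g (suc t)) (h (suc t)) (g (inject₁ t) ⊓ h (inject₁ t) + l t ≤_)
        (λ _ → ≤-trans (+-monoˡ-≤ (l t) (⊓-lower₁ _ _)) (proj₁ (∈⇒steps g g∈P t)))
        (λ _ → ≤-trans (+-monoˡ-≤ (l t) (⊓-lower₂ _ _)) (proj₁ (∈⇒steps h h∈P t))) ,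
      ⊓-elim (g (inject₁ t)) (h (inject₁ t)) (λ a → g (suc t) ⊓ h (suc t) ≤ a + u t)
        (λ _ → ≤-trans (⊓-lower₁ _ _) (proj₂ (∈⇒steps g g∈P t)))
        (λ _ → ≤-trans (⊓-lower₂ _ _) (proj₂ (∈⇒steps h h∈P t)))

    ⊔-∈ : ∀ g h → g ∈ P → h ∈ P → (λ x → g x ⊔ h x) ∈ P
    ⊔-∈ g h g∈P h∈P = steps⇒∈ (λ x → g x ⊔ h x) λ t →
      ⊔-elim (g (inject₁ t)) (h (inject₁ t)) (λ a → a + l t ≤ g (suc t) ⊔ h (suc t))
        (λ _ → ≤-trans (proj₁ (∈⇒steps g g∈P t)) (⊔-upper₁ _ _))
        (λ _ → ≤-trans (proj₁ (∈⇒steps h h∈P t)) (⊔-upper₂ _ _)) ,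
      ⊔-elim (g (suc t)) (h (suc t)) (_≤ g (inject₁ t) ⊔ h (inject₁ t) + u t)
        (λ _ → ≤-trans (proj₂ (∈⇒steps g g∈P t)) (+-monoˡ-≤ (u t) (⊔-upper₁ _ _)))
        (λ _ → ≤-trans (proj₂ (∈⇒steps h h∈P t)) (+-monoˡ-≤ (u t) (⊔-upper₂ _ _)))

    translate-∈ : ∀ c g → g ∈ P → (λ x → c + g x) ∈ P
    translate-∈ c g g∈P t = subst (l t ≤_) eq (proj₁ (g∈P t)) , subst (_≤ u t) eq (proj₂ (g∈P t))
      where
      eq : g (suc t) - g (inject₁ t) ≡ (c + g (suc t)) - (c + g (inject₁ t))
      eq = solve 3 (λ a b c → b :- a := (c :+ b) :- (c :+ a)) refl (g (inject₁ t)) (g (suc t)) c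

    Lo-∈ : Lo ∈ P
    Lo-∈ t = inj₂ (sym (prefix-step l t)) , subst (_≤ u t) (sym (prefix-step l t)) (inj₁ (l<u t))

    Hi-∈ : Hi ∈ P
    Hi-∈ t = subst (l t ≤_) (sym (prefix-step u t)) (inj₁ (l<u t)) , inj₂ (prefix-step u t)

    -- Extension of consistent partial functions.

    infimum : ∀ {k} (h : Fin (suc k) → Vector ℝ (suc m)) → (∀ i → h i ∈ P) →
              Σ (Vector ℝ (suc m)) λ g → g ∈ P × (∀ i x → g x ≤ h i x) ×
                (∀ x c → (∀ i → c ≤ h i x) → c ≤ g x)
    infimum {zero} h h∈P = h zero , h∈P zero , (λ { zero x → ≤-refl }) , λ x c c≤h → c≤h zero
    infimum {suc k} h h∈P with infimum (tail h) (h∈P ∘ suc)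
    ... | g , g∈P , lower , greatest =
      (λ x → h zero x ⊓ g x) , ⊓-∈ (h zero) g (h∈P zero) g∈P ,
      (λ { zero x → ⊓-lower₁ (h zero x) (g x)
         ; (suc i) x → ≤-trans (⊓-lower₂ (h zero x) (g x)) (lower i x) }) ,
      λ x c c≤h → ⊓-elim (h zero x) (g x) (c ≤_) (λ _ → c≤h zero) (λ _ → greatest x c (c≤h ∘ suc))

    -- The largest member of P with value a at y.
    cone : Fin (suc m) → ℝ → Vector ℝ (suc m)
    cone y a x = ((a - Hi y) + Hi x) ⊔ ((a - Lo y) + Lo x)

    cone-∈ : ∀ y a → cone y a ∈ P
    cone-∈ y a = ⊔-∈ (λ x → (a - Hi y) + Hi x) (λ x → (a - Lo y) + Lo x)
      (translate-∈ (a - Hi y) Hi Hi-∈) (translate-∈ (a - Lo y) Lo Lo-∈)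

    cone-apex : ∀ y a → cone y a y ≡ a
    cone-apex y a = ⊔-elim _ _ (_≡ a) (λ _ → cancel (Hi y)) (λ _ → cancel (Lo y))
      where
      cancel : ∀ b → (a - b) + b ≡ a
      cancel b = solve 2 (λ a b → (a :- b) :+ b := a) refl a b

    -- One branch of the maximum suffices on each side of the apex: before it the value is largest
    -- when growth towards `b` is least, hence `Lo`; after it, when growth is greatest, hence `Hi`.
    valid⇒≤cone : ∀ {x a y b} → Valid x a y b → a ≤ cone y b x
    valid⇒≤cone {x} {a} {y} {b} (x≤y⇒ , y≤x⇒) with ℕ.≤-total (toℕ x) (toℕ y)
    ... | inj₁ x≤y = ≤-trans
      (≤-by-difference (proj₁ (x≤y⇒ x≤y))
        (solve 4 (λ a b p q → (b :- q) :- (a :- p) := ((b :- q) :+ p) :- a) refl a b (Lo x) (Lo y)))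
      (⊔-upper₂ _ _)
    ... | inj₂ y≤x = ≤-trans
      (≤-by-difference (proj₂ (y≤x⇒ y≤x))
        (solve 4 (λ a b p q → (b :- q) :- (a :- p) := ((b :- q) :+ p) :- a) refl a b (Hi x) (Hi y)))
      (⊔-upper₁ _ _)

    -- McShane's extension: the pointwise minimum of the cones over S, the range
    -- of the retraction ρ.
    extension-along : {S : Fin (suc m) → Set} (f : Vector ℝ (suc m)) →
                      (∀ {x y} → S x → S y → Valid x (f x) y (f y)) →
                      (ρ : Fin (suc m) → Fin (suc m)) → (∀ y → S (ρ y)) → (∀ {x} → S x → ρ x ≡ x) →
                      Σ (Vector ℝ (suc m)) λ g → g ∈ P × (∀ {x} → S x → f x ≡ g x)
    extension-along f valid ρ ρ∈S ρ-fixes =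
      let g , g∈P , lower , greatest = infimum (λ y → cone (ρ y) (f (ρ y))) (λ y → cone-∈ (ρ y) (f (ρ y)))
      in  g , g∈P , λ {x} s → ≤-antisym
            -- Validity places `f x` below every cone; the cone with index `x` has its apex at `x`
            -- itself and gives the converse.
            (greatest x (f x) λ y → valid⇒≤cone (valid s (ρ∈S y)))
            (subst (g x ≤_) (trans (cong (λ y → cone y (f y) x) (ρ-fixes s)) (cone-apex x (f x))) (lower x x))

    -- Sending the points outside `S` to a fixed point of `S` is a retraction, so the minimum can
    -- range over the whole domain. An empty `S` imposes nothing, and `Lo` serves.
    extension : {S : Fin (suc m) → Set} (S? : ∀ x → Dec (S x)) (f : Vector ℝ (suc m)) →
                (∀ {x y} → S x → S y → Valid x (f x) y (f y)) →
                Σ (Vector ℝ (suc m)) λ g → g ∈ P × (∀ {x} → S x → f x ≡ g x)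
    extension {S} S? f valid = decide (Fin.any? S?)
      where
      decide : Dec (∃ S) → Σ (Vector ℝ (suc m)) λ g → g ∈ P × (∀ {x} → S x → f x ≡ g x)
      decide (no ¬∃S)        = Lo , Lo-∈ , λ {x} s → contradiction (x , s) ¬∃S
      decide (yes (y₀ , s₀)) = extension-along f valid (λ y → if does (S? y) then y else y₀)
        (λ y → does-elim (λ b → S (if b then y else y₀)) (S? y) id (λ _ → s₀))
        (λ {x} s → does-elim (λ b → (if b then x else y₀) ≡ x) (S? x) (λ _ → refl) (contradiction s))

-- The tester and the mass of inconsistent keys.

module Tester (R : Reals) {m : ℕ} (D : PropertyTesting.Distribution R (suc m))
              (P : PropertyTesting.BoundedDerivativeProperty R m) (T : BST 0 (suc m)) where
  open PropertyTesting R
  open OrderedField R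
  open Expectation R
  open Extension R
  open CommutativeRing commutativeRing using (*-identityʳ; *-identityˡ; *-comm; zeroˡ; zeroʳ;
    distribʳ; +-identityˡ; +-identityʳ)
  open ≡-Reasoning

  -- Tree keys are natural numbers; reduction modulo `suc m` is a total way back into the domain and
  -- fixes every key below `suc m`.
  ancestors : Fin (suc m) → List (Fin (suc m))
  ancestors v = map (_mod suc m) (path T (toℕ v))

  Good : Vector ℝ (suc m) → Fin (suc m) → Set
  Good f v = All (λ w → Valid P v (f v) w (f w)) (ancestors v)

  good? : ∀ f v → Dec (Good f v)
  good? f v = All.all? (λ w → valid? P v (f v) w (f w)) (ancestors v)

  toℕ-mod : ∀ {k} → k ℕ.< suc m → toℕ (k mod suc m) ≡ k
  toℕ-mod {k} k<n = trans (Fin.toℕ-fromℕ< (m%n<n k (suc m))) (m<n⇒m%n≡m k<n)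

  good⇒valid : ∀ f {x y} → Good f x → Good f y → Valid P x (f x) y (f y)
  good⇒valid f {x} {y} good-x good-y = compatible good-x good-y , compatible good-y good-x
    where
    valid-ancestor : ∀ {v k} → Good f v → k ℕ.< suc m → k ∈ˡ toℕ v ∷ path T (toℕ v) →
                     Valid P v (f v) (k mod suc m) (f (k mod suc m))
    -- The common ancestor may be the key itself, which no round checks against itself; reflexivity
    -- fills this case.
    valid-ancestor {v} good k<n (here k≡v) =
      subst (λ w → Valid P v (f v) w (f w)) (Fin.toℕ-injective (trans (sym k≡v) (sym (toℕ-mod k<n))))
        ((λ _ → compatible-refl P v (f v)) , (λ _ → compatible-refl P v (f v)))
    valid-ancestor good k<n (there k∈path) = All.lookup good (∈-map⁺ (_mod suc m) k∈path)

    compatible : ∀ {x y} → Good f x → Good f y → toℕ x ℕ.≤ toℕ y → Compatible P x (f x) y (f y)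
    compatible {x} {y} good-x good-y x≤y with common-ancestor T z≤n x≤y (Fin.toℕ<n y)
    ... | k , x≤k , k≤y , k∈x , k∈y = compatible-trans P x (k mod suc m) y
      -- Since `k` lies between `x` and `y`, the two checks are read through opposite halves of
      -- `Valid`.
      (proj₁ (valid-ancestor good-x k<n k∈x) (subst (toℕ x ℕ.≤_) (sym (toℕ-mod k<n)) x≤k))
      (proj₂ (valid-ancestor good-y k<n k∈y) (subst (ℕ._≤ toℕ y) (sym (toℕ-mod k<n)) k≤y))
      where
      k<n : k ℕ.< suc m
      k<n = ℕ.≤-<-trans k≤y (Fin.toℕ<n y)

  badMass : Vector ℝ (suc m) → ℝ
  badMass f = Pr D (λ v → ¬? (good? f v))

  -- Extending `f` from its good keys gives a member of `P` that differs from `f` only on bad keys,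
  -- so the distance is at most the bad mass.
  far⇒<badMass : ∀ {ε f} → Far D P ε f → ε < badMass f
  far⇒<badMass {ε} {f} (d , (_ , d≤) , ε<d) with extension P (good? f) f (good⇒valid f)
  ... | g , g∈P , f≡g = <-≤-trans ε<d (≤-trans (d≤ (g , g∈P))
    (Pr-mono D (λ x → ¬? (f x ≟ g x)) (λ x → ¬? (good? f x)) λ x f≢g good → f≢g (f≡g good)))

  probe : Fin (suc m) → List (Fin (suc m)) → Algorithm (suc m) → Algorithm (suc m)
  probe v []       A = A
  probe v (w ∷ ws) A =
    query v λ a → query w λ b → if does (valid? P v a w b) then probe v ws A else halt false

  -- The queries of a round in which no check fails; affordability is decided by this number before
  -- the round begins.
  cost : Fin (suc m) → ℕ
  cost v = length (ancestors v) ℕ.+ length (ancestors v)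

  -- `b` counts the queries left and `r` the rounds left. A round that samples the root costs
  -- nothing, so the query budget alone would not make the recursion terminate.
  tester : ℕ → ℕ → Algorithm (suc m)
  tester b zero    = halt true
  tester b (suc r) = sample D λ v →
    if does (cost v ℕ.≤? b) then probe v (ancestors v) (tester (b ℕ.∸ cost v) r) else halt true

  -- Query bound and verdicts.

  probe-queries : ∀ v ws {A b f} → QueriesAtMost b A f →
                  QueriesAtMost (length ws ℕ.+ length ws ℕ.+ b) (probe v ws A) f
  probe-queries v []       q = q
  probe-queries v (w ∷ ws) {A} {b} {f} q rewrite ℕ.+-suc (length ws) (length ws) =
    does-elim (λ c → QueriesAtMost (length ws ℕ.+ length ws ℕ.+ b) (if c then probe v ws A else halt false) f)
      (valid? P v (f v) w (f w)) (λ _ → probe-queries v ws q) (λ _ → tt)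

  tester-queries : ∀ b r f → QueriesAtMost b (tester b r) f
  tester-queries b zero    f = tt
  tester-queries b (suc r) f v =
    does-elim (λ c → QueriesAtMost b (if c then probe v (ancestors v) (tester (b ℕ.∸ cost v) r) else halt true) f)
      (cost v ℕ.≤? b)
      (λ c≤b → subst (λ q → QueriesAtMost q (probe v (ancestors v) (tester (b ℕ.∸ cost v) r)) f)
        (ℕ.m+[n∸m]≡n c≤b) (probe-queries v (ancestors v) (tester-queries (b ℕ.∸ cost v) r f)))
      (λ _ → tt)

  probe-good : ∀ c v ws A f → All (λ w → Valid P v (f v) w (f w)) ws →
               PrVerdict c (probe v ws A) f ≡ PrVerdict c A f
  probe-good c v []       A f []             = refl
  probe-good c v (w ∷ ws) A f (valid ∷ good) =
    does-elim (λ d → PrVerdict c (if d then probe v ws A else halt false) f ≡ PrVerdict c A f)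
      (valid? P v (f v) w (f w)) (λ _ → probe-good c v ws A f good) (contradiction valid)

  probe-bad : ∀ v ws A f → ¬ All (λ w → Valid P v (f v) w (f w)) ws → PrReject (probe v ws A) f ≡ 1#
  probe-bad v []       A f bad = contradiction [] bad
  probe-bad v (w ∷ ws) A f bad =
    does-elim (λ d → PrReject (if d then probe v ws A else halt false) f ≡ 1#)
      (valid? P v (f v) w (f w)) (λ valid → probe-bad v ws A f λ good → bad (valid ∷ good)) (λ _ → refl)

  -- The error is one-sided: a member of `P` passes every check, and exhausting either limit accepts
  -- as well.
  tester-accepts : ∀ b r {f} → f ∈ P → PrAccept (tester b r) f ≡ 1#
  tester-accepts b zero    f∈P = refl
  tester-accepts b (suc r) {f} f∈P = trans
    (𝔼-cong D λ v → does-elim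
      (λ c → PrAccept (if c then probe v (ancestors v) (tester (b ℕ.∸ cost v) r) else halt true) f ≡ 1#)
      (cost v ℕ.≤? b)
      (λ _ → trans
        (probe-good true v (ancestors v) (tester (b ℕ.∸ cost v) r) f
          (All.universal (λ w → ∈⇒valid P f∈P v w) (ancestors v)))
        (tester-accepts (b ℕ.∸ cost v) r f∈P))
      (λ _ → refl))
    (𝔼-const D 1#)

  expectedCost : 𝔼 D (fromℕ ∘ cost) ≡ fromℕ 2 * expectedDepth D T
  expectedCost = trans (𝔼-cong D cost≡) (𝔼-* D (fromℕ 2) (λ v → fromℕ (depth T (toℕ v))))
    where
    length≡ : ∀ v → length (ancestors v) ≡ depth T (toℕ v)
    length≡ v = trans (List.length-map (_mod suc m) (path T (toℕ v))) (length-path T (toℕ v))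
    cost≡ : ∀ v → fromℕ (cost v) ≡ fromℕ 2 * fromℕ (depth T (toℕ v))
    cost≡ v = begin
      fromℕ (cost v)             ≡⟨ cong (λ d → fromℕ (d ℕ.+ d)) (length≡ v) ⟩
      fromℕ (d ℕ.+ d)            ≡⟨ fromℕ-+ d d ⟩
      fromℕ d + fromℕ d          ≡⟨ solve 1 (λ x → x :+ x := con (ℤ.+ 2) :* x) refl (fromℕ d) ⟩
      fromℕ 2 * fromℕ d          ∎
      where
      d : ℕ
      d = depth T (toℕ v)

  -- The price of the query budget is w per query and that of the round limit z
  -- per round; the full budget and the full limit are worth at most 1 each.  On
  -- average a round spends w · 𝔼 cost + z, and it rejects with probability
  -- badMass f, earning K; so if it earns at least what it spends, the potential
  -- below is a submartingale that bounds the rejection probability.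
  module _ (f : Vector ℝ (suc m)) {w z K : ℝ} (0≤w : 0# ≤ w) (0≤z : 0# ≤ z) (0≤K : 0# ≤ K)
           (earns : w * 𝔼 D (fromℕ ∘ cost) + z ≤ K * badMass f) where

    potential : ℕ → ℕ → ℝ
    potential b r = (fromℕ (suc b) * w + fromℕ r * z) - (1# + K)

    gain : Vector ℝ (suc m)
    gain v = K * indicator D (λ v → ¬? (good? f v)) v - (w * fromℕ (cost v) + z)

    𝔼-gain : 𝔼 D gain ≡ K * badMass f - (w * 𝔼 D (fromℕ ∘ cost) + z)
    𝔼-gain = trans (𝔼-- D (λ v → K * bad v) (λ v → w * fromℕ (cost v) + z)) (cong₂ _-_
      (trans (𝔼-* D K bad) (cong (K *_) (sym (Pr≡𝔼-indicator D (λ v → ¬? (good? f v))))))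
      (trans (𝔼-+ D (λ v → w * fromℕ (cost v)) (λ _ → z))
        (cong₂ _+_ (𝔼-* D w (fromℕ ∘ cost)) (𝔼-const D z))))
      where
      bad : Vector ℝ (suc m)
      bad = indicator D (λ v → ¬? (good? f v))

    0≤𝔼-gain : 0# ≤ 𝔼 D gain
    0≤𝔼-gain = subst (0# ≤_) (sym 𝔼-gain)
      (≤-by-difference earns (solve 1 (λ x → x := x :- con (ℤ.+ 0)) refl _))

    gain-good : ∀ v → Good f v → gain v ≡ - (w * fromℕ (cost v) + z)
    gain-good v good = does-elim
      (λ d → K * (if d then 1# else 0#) - (w * fromℕ (cost v) + z) ≡ - (w * fromℕ (cost v) + z))
      (¬? (good? f v)) (contradiction good)
      (λ _ → trans (cong (_- (w * fromℕ (cost v) + z)) (zeroʳ K)) (+-identityˡ _))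

    gain≤ : ∀ v → gain v ≤ K - w * fromℕ (cost v)
    gain≤ v = ≤-by-difference (+-mono-≤ K*bad≤K 0≤z)
      (solve 4 (λ e K c z → (K :+ z) :- (e :+ con (ℤ.+ 0)) := (K :- c) :- (e :- (c :+ z))) refl
        (K * indicator D (λ v → ¬? (good? f v)) v) K (w * fromℕ (cost v)) z)
      where
      K*bad≤K : K * indicator D (λ v → ¬? (good? f v)) v ≤ K
      K*bad≤K = does-elim (λ d → K * (if d then 1# else 0#) ≤ K) (¬? (good? f v))
        (λ _ → inj₂ (*-identityʳ K)) (λ _ → subst (_≤ K) (sym (zeroʳ K)) 0≤K)

    potential-mono : ∀ {b r x y} → fromℕ (suc b) * w ≤ x → fromℕ r * z ≤ y → potential b r ≤ (x + y) - (1# + K)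
    potential-mono bw≤x rz≤y = +-monoˡ-≤ (- (1# + K)) (+-mono-≤ bw≤x rz≤y)

    -- An unaffordable round costs at least `suc b` queries, which is why the potential counts
    -- `suc b`. The price of the round then covers the budget term, and the remaining terms cancel.
    overspent : ∀ b r v → fromℕ (suc r) * z ≤ 1# → b ℕ.< cost v → potential b (suc r) + gain v ≤ 0#
    overspent b r v rz≤1 b<c = ≤-trans
      (+-mono-≤ (potential-mono {b} {suc r} (*-monoˡ-≤ 0≤w (fromℕ-mono b<c)) rz≤1) (gain≤ v))
      (inj₂ (trans (cong (λ c → ((c + 1#) - (1# + K)) + (K - w * fromℕ (cost v))) (*-comm (fromℕ (cost v)) w))
        (solve 3 (λ c o K → ((c :+ o) :- (o :+ K)) :+ (K :- c) := con (ℤ.+ 0)) refl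
          (w * fromℕ (cost v)) 1# K)))

    -- For rounds that find a violation, where rejection is certain: the potential is at most
    -- `1# - K` and the gain at most `K`.
    affordable : ∀ b r v → fromℕ (suc b) * w ≤ 1# → fromℕ (suc r) * z ≤ 1# → potential b (suc r) + gain v ≤ 1#
    affordable b r v bw≤1 rz≤1 = ≤-by-difference
      (+-mono-≤ (+-mono-≤ (potential-mono {b} {suc r} bw≤1 rz≤1) (gain≤ v))
                (*-nonneg 0≤w (fromℕ-nonneg (cost v))))
      (solve 5 (λ p g c o K →
          ((((o :+ o) :- (o :+ K)) :+ (K :- c)) :+ c) :- ((p :+ g) :+ con (ℤ.+ 0)) := o :- (p :+ g))
        refl (potential b (suc r)) (gain v) (w * fromℕ (cost v)) 1# K)

    -- A good round earns nothing, so its gain is minus the price of exactly the queries and the one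
    -- round that the two limits lose.
    continued : ∀ b r v → cost v ℕ.≤ b → Good f v →
                potential b (suc r) + gain v ≡ potential (b ℕ.∸ cost v) r
    continued b r v c≤b good = begin
      potential b (suc r) + gain v
        ≡⟨ cong₂ (λ B g → ((B + fromℕ (suc r) * z) - (1# + K)) + g) budget (gain-good v good) ⟩
      (((B′ * w + w * c) + fromℕ (suc r) * z) - (1# + K)) - (w * c + z)
        ≡⟨ cong (λ y → (((B′ * w + w * c) + y) - (1# + K)) - (w * c + z)) rounds ⟩
      (((B′ * w + w * c) + (z + fromℕ r * z)) - (1# + K)) - (w * c + z)
        ≡⟨ solve 5 (λ X Y Z z k → (((X :+ Y) :+ (z :+ Z)) :- k) :- (Y :+ z) := (X :+ Z) :- k) refl
             (B′ * w) (w * c) (fromℕ r * z) z (1# + K) ⟩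
      potential (b ℕ.∸ cost v) r ∎
      where
      B′ c : ℝ
      B′ = fromℕ (suc (b ℕ.∸ cost v))
      c  = fromℕ (cost v)
      budget : fromℕ (suc b) * w ≡ B′ * w + w * c
      budget = begin
        fromℕ (suc b) * w
          ≡⟨ cong (λ k → fromℕ (suc k) * w) (ℕ.m∸n+n≡m c≤b) ⟨
        fromℕ (suc (b ℕ.∸ cost v) ℕ.+ cost v) * w
          ≡⟨ cong (_* w) (fromℕ-+ (suc (b ℕ.∸ cost v)) (cost v)) ⟩
        (B′ + c) * w
          ≡⟨ solve 3 (λ B c w → (B :+ c) :* w := B :* w :+ w :* c) refl B′ c w ⟩
        B′ * w + w * c ∎
      rounds : fromℕ (suc r) * z ≡ z + fromℕ r * z
      rounds = trans (distribʳ z 1# (fromℕ r)) (cong (_+ fromℕ r * z) (*-identityˡ z))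

    -- Induction on rounds. Adding the gain does not lower the mean, and pointwise the sum is at
    -- most 0 if the round is unaffordable, at most 1 if it rejects, and the next potential
    -- otherwise.
    potential≤PrReject : ∀ b r → fromℕ (suc b) * w ≤ 1# → fromℕ r * z ≤ 1# →
                         potential b r ≤ PrReject (tester b r) f
    -- With no rounds left the potential is at most `- K`, and the rejection probability is 0.
    potential≤PrReject b zero bw≤1 _ = ≤-trans (potential-mono {b} {0} bw≤1 (inj₂ (zeroˡ z)))
      (≤-by-difference 0≤K (solve 2 (λ o K → K :- con (ℤ.+ 0) := con (ℤ.+ 0) :- ((o :+ con (ℤ.+ 0)) :- (o :+ K))) refl 1# K))
    potential≤PrReject b (suc r) bw≤1 rz≤1 = ≤-trans potential≤𝔼 (𝔼-mono D outcome)
      where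
      potential≤𝔼 : potential b (suc r) ≤ 𝔼 D (λ v → potential b (suc r) + gain v)
      potential≤𝔼 = subst₂ _≤_ (+-identityʳ (potential b (suc r)))
        (sym (trans (𝔼-+ D (λ _ → potential b (suc r)) gain)
                    (cong (_+ 𝔼 D gain) (𝔼-const D (potential b (suc r))))))
        (+-mono-≤ ≤-refl 0≤𝔼-gain)
      next : Fin (suc m) → Algorithm (suc m)
      next v = tester (b ℕ.∸ cost v) r
      b′w≤1 : ∀ v → fromℕ (suc (b ℕ.∸ cost v)) * w ≤ 1#
      b′w≤1 v = ≤-trans (*-monoˡ-≤ 0≤w (fromℕ-mono (s≤s (ℕ.m∸n≤m b (cost v))))) bw≤1
      r′z≤1 : fromℕ r * z ≤ 1#
      r′z≤1 = ≤-trans (*-monoˡ-≤ 0≤z (fromℕ-mono (ℕ.n≤1+n r))) rz≤1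
      affordable-outcome : ∀ v → cost v ℕ.≤ b → Dec (Good f v) →
                           potential b (suc r) + gain v ≤ PrReject (probe v (ancestors v) (next v)) f
      affordable-outcome v c≤b (yes good) = subst₂ _≤_
        (sym (continued b r v c≤b good)) (sym (probe-good false v (ancestors v) (next v) f good))
        (potential≤PrReject (b ℕ.∸ cost v) r (b′w≤1 v) r′z≤1)
      affordable-outcome v c≤b (no ¬good) = subst (potential b (suc r) + gain v ≤_)
        (sym (probe-bad v (ancestors v) (next v) f ¬good)) (affordable b r v bw≤1 rz≤1)
      outcome : ∀ v → potential b (suc r) + gain v ≤
                PrReject (if does (cost v ℕ.≤? b) then probe v (ancestors v) (next v) else halt true) f
      outcome v = does-elim
        (λ d → potential b (suc r) + gain v ≤ PrReject (if d then probe v (ancestors v) (next v) else halt true) f)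
        (cost v ℕ.≤? b)
        (λ c≤b → affordable-outcome v c≤b (good? f v))
        (λ c≰b → overspent b r v rz≤1 (ℕ.≰⇒> c≰b))

-- Choice of the limits and the error bound.

module Analysis (R : Reals) where
  open PropertyTesting R
  open OrderedField R
  open CommutativeRing commutativeRing using (*-identityʳ; *-identityˡ; *-comm; +-identityʳ)
  open ≡-Reasoning

  -- The factor 12 clears the denominators of 2/3 and of the two error terms 1/12 and 1/4, whose sum
  -- is 1/3.
  ⅔<1-K : ∀ {K} → fromℕ 12 * K < fromℕ 4 → ⅔ < 1# - K
  ⅔<1-K {K} 12K<4 = *-cancelˡ-< (fromℕ-nonneg 12) (<-by-difference 12K<4 (begin
    fromℕ 4 - fromℕ 12 * K
      ≡⟨ solve 1 (λ K → con (ℤ.+ 4) :- con (ℤ.+ 12) :* K :=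
                        con (ℤ.+ 12) :* (con (ℤ.+ 1) :- K) :- con (ℤ.+ 8)) refl K ⟩
    fromℕ 12 * (fromℕ 1 - K) - fromℕ 8
      ≡⟨ cong₂ (λ o e → fromℕ 12 * (o - K) - e) (+-identityʳ 1#) (sym 12*⅔≡8) ⟩
    fromℕ 12 * (1# - K) - fromℕ 12 * ⅔ ∎))
    where
    12*⅔≡8 : fromℕ 12 * ⅔ ≡ fromℕ 8
    12*⅔≡8 = begin
      fromℕ 12 * (fromℕ 2 * fromℕ 3 ⁻¹)
        ≡⟨ solve 1 (λ t → con (ℤ.+ 12) :* (con (ℤ.+ 2) :* t) := con (ℤ.+ 8) :* (t :* con (ℤ.+ 3)))
             refl (fromℕ 3 ⁻¹) ⟩
      fromℕ 8 * (fromℕ 3 ⁻¹ * fromℕ 3)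
        ≡⟨ cong (fromℕ 8 *_) (⁻¹-inverseˡ (fromℕ-pos 2)) ⟩
      fromℕ 8 * 1#
        ≡⟨ *-identityʳ (fromℕ 8) ⟩
      fromℕ 8 ∎

  ⅔<1 : ⅔ < 1#
  ⅔<1 = subst (⅔ <_) (solve 1 (λ o → o :- con (ℤ.+ 0) := o) refl 1#)
    (⅔<1-K (subst (_< fromℕ 4) (solve 0 (con (ℤ.+ 0) := con (ℤ.+ 12) :* con (ℤ.+ 0)) refl) (fromℕ-pos 3)))

  *⁻¹-< : ∀ n {x} → x < fromℕ (suc n) → x * fromℕ (suc n) ⁻¹ < 1#
  *⁻¹-< n {x} x<n = subst₂ _<_ (*-comm (fromℕ (suc n) ⁻¹) x) (⁻¹-inverseˡ (fromℕ-pos n))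
    (*-monoʳ-< (⁻¹-pos (fromℕ-pos n)) x<n)

  -- The left side is `24 e Δ w` plus three copies of `4 e z`: four terms below 1. The query budget
  -- thus accounts for 1/12 of the error and the round limit for 1/4.
  12K<4 : ∀ {e Δ w z} → fromℕ 24 * e * Δ * w < 1# → fromℕ 4 * e * z < 1# →
          fromℕ 12 * (e * (w * (fromℕ 2 * Δ) + z)) < fromℕ 4
  12K<4 {e} {Δ} {w} {z} A<1 B<1 = <-by-difference
    (+-mono-<-≤ A<1 (+-mono-≤ (+-mono-≤ (inj₁ B<1) (inj₁ B<1)) (inj₁ B<1)))
    (cong₂ _-_
      (trans (cong (λ o → o + (o + o + o)) (sym (+-identityʳ 1#)))
        (solve 0 (con (ℤ.+ 1) :+ (con (ℤ.+ 1) :+ con (ℤ.+ 1) :+ con (ℤ.+ 1)) := con (ℤ.+ 4)) refl))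
      (solve 4 (λ e Δ w z →
          con (ℤ.+ 24) :* e :* Δ :* w :+
            (con (ℤ.+ 4) :* e :* z :+ con (ℤ.+ 4) :* e :* z :+ con (ℤ.+ 4) :* e :* z)
          := con (ℤ.+ 12) :* (e :* (w :* (con (ℤ.+ 2) :* Δ) :+ z)))
        refl e Δ w z))

  module _ {m : ℕ} (D : Distribution (suc m)) {ε : ℝ} (0<ε : 0# < ε)
           (P : BoundedDerivativeProperty m) (T : BST 0 (suc m)) where
    open Tester R D P T
    open Expectation R

    Δ : ℝ
    Δ = expectedDepth D T

    0≤Δ : 0# ≤ Δ
    0≤Δ = subst (_≤ Δ) (𝔼-const D 0#) (𝔼-mono D λ v → fromℕ-nonneg (depth T (toℕ v)))

    0≤queries : 0# ≤ fromℕ 24 * ε ⁻¹ * Δ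
    0≤queries = *-nonneg (*-nonneg (fromℕ-nonneg 24) (inj₁ (⁻¹-pos 0<ε))) 0≤Δ

    rejects : ∀ q s → fromℕ 24 * ε ⁻¹ * Δ < fromℕ (suc q) → fromℕ 4 * ε ⁻¹ < fromℕ (suc s) →
              ∀ f → Far D P ε f → ⅔ < PrReject (tester q (suc s)) f
    rejects q s queries< rounds< f far = <-≤-trans
      (⅔<1-K (12K<4 (*⁻¹-< q queries<) (*⁻¹-< s rounds<)))
      (subst (_≤ PrReject (tester q (suc s)) f) initial
        (potential≤PrReject f (inj₁ 0<w) (inj₁ 0<z) 0≤K earns q (suc s) (inj₂ qw≡1) (inj₂ sz≡1)))
      where
      w z K : ℝ
      -- At these prices `suc q` queries and `suc s` rounds are worth exactly 1 each, so the initial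
      -- potential is `1# - K`.
      w = fromℕ (suc q) ⁻¹
      z = fromℕ (suc s) ⁻¹
      -- Chosen so that `K * ε` is the mean price of a round; a bad mass above `ε` then pays for it.
      K = ε ⁻¹ * (w * (fromℕ 2 * Δ) + z)
      0<w : 0# < w
      0<w = ⁻¹-pos (fromℕ-pos q)
      0<z : 0# < z
      0<z = ⁻¹-pos (fromℕ-pos s)
      qw≡1 : fromℕ (suc q) * w ≡ 1#
      qw≡1 = trans (*-comm (fromℕ (suc q)) w) (⁻¹-inverseˡ (fromℕ-pos q))
      sz≡1 : fromℕ (suc s) * z ≡ 1#
      sz≡1 = trans (*-comm (fromℕ (suc s)) z) (⁻¹-inverseˡ (fromℕ-pos s))
      0≤K : 0# ≤ K
      0≤K = *-nonneg (inj₁ (⁻¹-pos 0<ε)) (subst (_≤ w * (fromℕ 2 * Δ) + z) (+-identityʳ 0#)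
        (+-mono-≤ (*-nonneg (inj₁ 0<w) (*-nonneg (fromℕ-nonneg 2) 0≤Δ)) (inj₁ 0<z)))
      earns : w * 𝔼 D (fromℕ ∘ cost) + z ≤ K * badMass f
      earns = subst (_≤ K * badMass f) (begin
        K * ε
          ≡⟨ solve 3 (λ i x ε → (i :* x) :* ε := (i :* ε) :* x) refl (ε ⁻¹) (w * (fromℕ 2 * Δ) + z) ε ⟩
        (ε ⁻¹ * ε) * (w * (fromℕ 2 * Δ) + z)
          ≡⟨ cong (_* (w * (fromℕ 2 * Δ) + z)) (⁻¹-inverseˡ 0<ε) ⟩
        1# * (w * (fromℕ 2 * Δ) + z)
          ≡⟨ *-identityˡ _ ⟩
        w * (fromℕ 2 * Δ) + z
          ≡⟨ cong (λ c → w * c + z) expectedCost ⟨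
        w * 𝔼 D (fromℕ ∘ cost) + z ∎)
        (*-monoʳ-≤ 0≤K (inj₁ (far⇒<badMass {ε} {f} far)))
      initial : (fromℕ (suc q) * w + fromℕ (suc s) * z) - (1# + K) ≡ 1# - K
      initial = trans (cong₂ (λ x y → (x + y) - (1# + K)) qw≡1 sz≡1)
        (solve 2 (λ o K → (o :+ o) :- (o :+ K) := o :- K) refl 1# K)

    exists-tester : ∃[ A ] (IsTester D ε P A ×
      (∃[ q ] (fromℕ q ≤ fromℕ 24 * ε ⁻¹ * Δ × (∀ f → QueriesAtMost q A f))))
    exists-tester =
      let q , q≤ , queries< = floor 0≤queries
          -- Taking `suc s` rounds, more than `4 ε ⁻¹`, keeps `ε ⁻¹ * z` below 1/4.
          s , _ , rounds<   = floor (*-nonneg (fromℕ-nonneg 4) (inj₁ (⁻¹-pos 0<ε)))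
      in  tester q (suc s) ,
          record
            { accepts = λ f f∈P → subst (⅔ <_) (sym (tester-accepts q (suc s) f∈P)) ⅔<1
            ; rejects = rejects q s queries< rounds<
            } ,
          q , q≤ , tester-queries q (suc s)

theorem4p3 : (R : Reals) → let open PropertyTesting R in
    (m : ℕ) (D : Distribution (suc m)) (ε : ℝ) → 0# < ε →
    (P : BoundedDerivativeProperty m) (Δ* : ℝ) → Is-Δ* D Δ* →
    ∃[ T ] (IsTester D ε P T ×
    (∃[ q ] (fromℕ q ≤ fromℕ 24 * ε ⁻¹ * Δ* × (∀ f → QueriesAtMost q T f))))
-- The minimum is attained: matching on `refl` turns `Δ*` into the expected depth of an optimal tree
-- `T`.
theorem4p3 R m D ε 0<ε P Δ* ((T , refl) , _) = Analysis.exists-tester R D 0<ε P T
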